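{- Let a product two-action game with $m$ players and characteristic tuple $(\underline v,\sigma^1,\dots,\sigma^m)$ be given. Let $\pi\in S_m$ with $F(\pi)\neq\emptyset$, and for $\underline\gamma\in EC(\pi)$ define the increment map $\mathrm{Inc}(\underline\gamma):F(\pi)\to\{0,1\}$ by $$\mathrm{Inc}(\underline\gamma,i):=\Bigl(1+\gamma^i+v_i+|L_0(\underline\gamma)\setminus\{i\}|+\sum_{j\in\mathcal A\setminus F(\pi)}\chi\bigl(\sigma^j(\pi(j)),\sigma^j(i)\bigr)\Bigr)\bmod 2,$$ where $\chi:\mathbb R\times\mathbb R\to\{0,1\}$ is given by $\chi(a,b)=1$ iff $a\ge b$. Then: (i) $\underline\gamma\in EC(\pi)$ is a Nash equilibrium if and only if $\mathrm{Inc}(\underline\gamma,i)=0$ for all $i\in F(\pi)$. (ii) Let $g(\pi)\in EC(\pi)$ be the point with $\gamma^i=1$ for all $i\in F(\pi)$. The map $\underline\gamma\mapsto\mathrm{Inc}(\underline\gamma)$ on $EC(\pi)$ takes only two values: the map $\mathrm{Inc}(g(\pi))$ and its opposite $i\mapsto (1+\mathrm{Inc}(g(\pi),i))\bmod 2$. Moreover $\mathrm{Inc}(\underline\gamma)=\mathrm{Inc}(g(\pi))$ if and only if $|L_0(\underline\gamma)|$ is even. (iii) Either $EC(\pi)$ contains no Nash equilibrium, or exactly half of its elements are Nash equilibria.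
   Context: Fix an integer $m\ge 1$ and $\mathcal A=\{1,\dots,m\}$. A two-action game is a finite game in normal form with player set $\mathcal A$ in which each player $i$ has exactly two pure strategies $s^i_0,s^i_1$, together with utility functions $U^i:S\to\mathbb R$, where $S=\prod_{i\in\mathcal A}\{s^i_0,s^i_1\}$. A mixed strategy combination is identified with $\underline\gamma=(\gamma^1,\dots,\gamma^m)\in[0,1]^m$, where $\gamma^i$ is the probability with which player $i$ plays $s^i_1$. The expected utility $V^i$ is the multilinear extension $V^i(\underline\gamma)=\sum_{(j_1,\dots,j_m)\in\{0,1\}^m}\prod_{k=1}^m p_k(j_k)\,U^i(s^1_{j_1},\dots,s^m_{j_m})$ with $p_k(1)=\gamma^k$, $p_k(0)=1-\gamma^k$. Write $\underline\gamma^{ -i}=(\gamma^j)_{j\ne i}$ and $\lambda^i(\underline\gamma^{ -i}):=V^i(\underline\gamma)|_{\gamma^i=1}-V^i(\underline\gamma)|_{\gamma^i=0}$. A Nash equilibrium is a point $\underline\gamma\in[0,1]^m$ such that for every $i$: $\lambda^i(\underline\gamma^{ -i})=0$ if $0<\gamma^i<1$; $\lambda^i(\underline\gamma^{ -i})\le 0$ if $\gamma^i=0$; $\lambda^i(\underline\gamma^{ -i})\ge 0$ if $\gamma^i=1$. For $\underline\gamma$ put $L_0(\underline\gamma)=\{i:\gamma^i=0\}$, $L_1(\underline\gamma)=\{i:\gamma^i=1\}$, $L(\underline\gamma)=L_0(\underline\gamma)\cup L_1(\underline\gamma)$. A two-action game is a product two-action game if there exist $\underline v=(v_1,\dots,v_m)\in\{0,1\}^m$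 and numbers $a^i_j\in(0,1)$ for $i,j\in\mathcal A$, $i\ne j$, with $a^{i_1}_j\neq a^{i_2}_j$ whenever $i_1\neq i_2$ and both differ from $j$, such that $\lambda^i(\underline\gamma^{ -i})=(-1)^{v_i}\prod_{j\in\mathcal A\setminus\{i\}}(\gamma^j-a^i_j)$ for every $i\in\mathcal A$. For $j\in\mathcal A$ the $j$-th associated permutation $\sigma^j\in S_m$ is the unique permutation with $\sigma^j(j)=j$ such that for $i,i'\in\mathcal A\setminus\{j\}$ one has $\sigma^j(i)<\sigma^j(i')$ iff $a^i_j>a^{i'}_j$. The tuple $(\underline v,\sigma^1,\dots,\sigma^m)$ is the characteristic tuple of the game. For $\pi\in S_m$, $F(\pi)=\{i\in\mathcal A:\pi(i)=i\}$ and $EC(\pi):=\{\underline\gamma\in[0,1]^m \mid L(\underline\gamma)=F(\pi),\ \gamma^j=a^{\pi(j)}_j \text{ for all } j\notin F(\pi)\}$. -}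

module Defs where

open import Algebra.Apartness.Bundles using (HeytingField)
open import Algebra.Bundles using (CommutativeRing; Semiring)
import Algebra.Definitions.RawSemiring as RawSemiringOps
open import Data.Bool.Base using (if_then_else_)
open import Data.Fin.Base as Fin using (Fin; toℕ)
import Data.Fin.Properties as Fin
open import Data.Fin.Permutation using (Permutation′; _⟨$⟩ʳ_)
open import Data.List.Base using (List; [_]; map; foldr; filter; length; allFin; cartesianProductWith)
open import Data.Nat.ListAction using (sum)
open import Data.Nat.Base as ℕ using (ℕ)
open import Data.Nat.DivMod using (_mod_)
open import Data.Product.Base using (∃; ∃-syntax; _×_; _,_; proj₁)
open import Data.Sum.Base using (_⊎_; inj₁; inj₂)
open import Data.Vec.Base as Vec using (Vec)
open import Data.Vec.Functional using (Vector; updateAt)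
import Data.Vec.Functional.Relation.Binary.Equality.Setoid as VecEq
open import Function.Base using (_∘_; const)
open import Function.Bundles using (_⇔_; Equivalence; Inverse)
open import Level using (_⊔_; suc; 0ℓ)
open import Relation.Binary.Core using (Rel)
import Relation.Binary.Construct.On as On
open import Relation.Binary.PropositionalEquality.Core using (_≡_; _≢_)
import Relation.Binary.PropositionalEquality.Properties as ≡
open import Relation.Binary.Structures using (IsStrictPartialOrder)
open import Relation.Nullary using (¬_; yes; no; does; ¬?)
open import Relation.Unary using (Pred; Decidable; _∈_; _∪_)

-- The real numbers, axiomatically: an Archimedean, Cauchy complete ordered
-- field. Classically this determines ℝ up to unique isomorphism. Equality and
-- order are not assumed decidable, so constructive models are covered as well;
-- x # y is the positive form of x ≠ y.
record RealNumbers c ℓ₁ ℓ₂ ℓ₃ : Set (suc (c ⊔ ℓ₁ ⊔ ℓ₂ ⊔ ℓ₃)) where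
  infix 4 _<_ _≤_ _≉_

  field
    heytingField : HeytingField c ℓ₁ ℓ₂

  open HeytingField heytingField public

  commutativeRing : CommutativeRing c ℓ₁
  commutativeRing = record { isCommutativeRing = isCommutativeRing }

  open Semiring (CommutativeRing.semiring commutativeRing) public using (rawSemiring)
  open RawSemiringOps rawSemiring public using (_^_) renaming (_×_ to _·_)

  _≉_ : Rel Carrier ℓ₁
  x ≉ y = ¬ (x ≈ y)

  field
    _<_                  : Rel Carrier ℓ₃
    isStrictPartialOrder : IsStrictPartialOrder _≈_ _<_
    #⇔<⊎>                : ∀ {x y} → x # y ⇔ (x < y ⊎ y < x)
    0<1                  : 0# < 1#
    +-monoˡ-<            : ∀ z {x y} → x < y → x + z < y + z
    *-pos                : ∀ {x y} → 0# < x → 0# < y → 0# < x * y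
    archimedean          : ∀ x → ∃[ n ] x < n · 1#

  _≤_ : Rel Carrier ℓ₃
  x ≤ y = ¬ (y < x)

  IsCauchy : (ℕ → Carrier) → Set (c ⊔ ℓ₃)
  IsCauchy s = ∀ ε → 0# < ε → ∃[ N ] ∀ p q → N ℕ.≤ p → N ℕ.≤ q → s p < s q + ε

  _ConvergesTo_ : (ℕ → Carrier) → Carrier → Set (c ⊔ ℓ₃)
  s ConvergesTo l =
    ∀ ε → 0# < ε → ∃[ N ] ∀ n → N ℕ.≤ n → (s n < l + ε) × (l < s n + ε)

  field
    complete : ∀ s → IsCauchy s → ∃[ l ] s ConvergesTo l

module Games {c ℓ₁ ℓ₂ ℓ₃} (R : RealNumbers c ℓ₁ ℓ₂ ℓ₃) where

  open RealNumbers R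

  ∑ ∏ : ∀ {a} {A : Set a} → List A → (A → Carrier) → Carrier
  ∑ xs f = foldr _+_ 0# (map f xs)
  ∏ xs f = foldr _*_ 1# (map f xs)

  -- Players are Fin m; the strategy sⁱⱼ is represented by its index j : Fin 2.
  Profile : ℕ → Set
  Profile = Vec (Fin 2)

  profiles : ∀ m → List (Profile m)
  profiles ℕ.zero    = [ Vec.[] ]
  profiles (ℕ.suc m) = cartesianProductWith Vec._∷_ (allFin 2) (profiles m)

  TwoActionGame : ℕ → Set c
  TwoActionGame m = Fin m → Profile m → Carrier

  Point : ℕ → Set c
  Point = Vector Carrier

  _except_ : ∀ {m} → List (Fin m) → Fin m → List (Fin m)
  xs except i = filter (λ j → ¬? (j Fin.≟ i)) xs

  opposite : ∀ {b} {B : Set b} → (B → Fin 2) → B → Fin 2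
  opposite f x = (1 ℕ.+ toℕ (f x)) mod 2

  prob : Carrier → Fin 2 → Carrier
  prob x Fin.zero    = 1# - x
  prob x (Fin.suc _) = x

  0≉1 : 0# ≉ 1#
  0≉1 0≈1 = IsStrictPartialOrder.irrefl isStrictPartialOrder 0≈1 0<1

  module _ {m : ℕ} where

    InUnitCube : Pred (Point m) ℓ₃
    InUnitCube γ = ∀ i → (0# ≤ γ i) × (γ i ≤ 1#)

    expectedUtility : TwoActionGame m → Fin m → Point m → Carrier
    expectedUtility U i γ =
      ∑ (profiles m) λ s → ∏ (allFin m) (λ k → prob (γ k) (Vec.lookup s k)) * U i s

    -- λⁱ as a function of the whole point γ; the entry γⁱ is overwritten.
    gain : TwoActionGame m → Fin m → Point m → Carrier
    gain U i γ = expectedUtility U i (updateAt γ i (const 1#))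
               - expectedUtility U i (updateAt γ i (const 0#))

    record IsNash (U : TwoActionGame m) (γ : Point m) : Set (ℓ₁ ⊔ ℓ₃) where
      field
        inUnitCube : InUnitCube γ
        mixed      : ∀ i → 0# < γ i → γ i < 1# → gain U i γ ≈ 0#
        pure₀      : ∀ i → γ i ≈ 0# → gain U i γ ≤ 0#
        pure₁      : ∀ i → γ i ≈ 1# → 0# ≤ gain U i γ

    L₀ L₁ L : Point m → Pred (Fin m) ℓ₁
    L₀ γ i = γ i ≈ 0#
    L₁ γ i = γ i ≈ 1#
    L γ = L₀ γ ∪ L₁ γ

    -- a i j stands for aⁱⱼ; the diagonal entries are unconstrained and unused.
    record IsProductGame (U : TwoActionGame m) (v : Fin m → Fin 2)
                         (a : Fin m → Fin m → Carrier) : Set (c ⊔ ℓ₁ ⊔ ℓ₃) where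
      field
        a-in-unit  : ∀ i j → i ≢ j → (0# < a i j) × (a i j < 1#)
        a-distinct : ∀ i₁ i₂ j → i₁ ≢ i₂ → i₁ ≢ j → i₂ ≢ j → a i₁ j ≉ a i₂ j
        gain≈      : ∀ i γ → InUnitCube γ →
                     gain U i γ ≈ (- 1#) ^ toℕ (v i) * ∏ (allFin m except i) (λ j → γ j - a i j)

    IsAssociatedPermutation : (a : Fin m → Fin m → Carrier) → Fin m → Permutation′ m → Set ℓ₃
    IsAssociatedPermutation a j σ =
      (σ ⟨$⟩ʳ j ≡ j) ×
      (∀ i i′ → i ≢ j → i′ ≢ j → ((σ ⟨$⟩ʳ i) Fin.< (σ ⟨$⟩ʳ i′)) ⇔ (a i′ j < a i j))

    F : Permutation′ m → Pred (Fin m) 0ℓ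
    F π i = π ⟨$⟩ʳ i ≡ i

    F? : ∀ π → Decidable (F π)
    F? π i = (π ⟨$⟩ʳ i) Fin.≟ i

    record EC (a : Fin m → Fin m → Carrier) (π : Permutation′ m) (γ : Point m) : Set (ℓ₁ ⊔ ℓ₃) where
      field
        inUnitCube : InUnitCube γ
        L≐F        : ∀ i → (i ∈ L γ) ⇔ (i ∈ F π)
        off-F      : ∀ j → ¬ (j ∈ F π) → γ j ≈ a (π ⟨$⟩ʳ j) j

    g : (a : Fin m → Fin m → Carrier) → Permutation′ m → Point m
    g a π i = if does (F? π i) then 1# else a (π ⟨$⟩ʳ i) i

    χ : Fin m → Fin m → ℕ
    χ k l = if does (l Fin.≤? k) then 1 else 0

    module _ {a : Fin m → Fin m → Carrier} {π : Permutation′ m} {γ : Point m} (γ∈EC : γ ∈ EC a π) where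

      open EC γ∈EC

      L₀? : Decidable (L₀ γ)
      L₀? i with F? π i
      ... | no  i∉F = no λ γi≈0 → i∉F (Equivalence.to (L≐F i) (inj₁ γi≈0))
      ... | yes i∈F with Equivalence.from (L≐F i) i∈F
      ...   | inj₁ γi≈0 = yes γi≈0
      ...   | inj₂ γi≈1 = no λ γi≈0 → 0≉1 (trans (sym γi≈0) γi≈1)

      L₀-list : List (Fin m)
      L₀-list = filter L₀? (allFin m)

      -- γⁱ, which is 0 or 1 for i ∈ F(π), as a natural number
      bit : ∀ {i} → i ∈ F π → ℕ
      bit {i} i∈F with Equivalence.from (L≐F i) i∈F
      ... | inj₁ _ = 0
      ... | inj₂ _ = 1

      Inc : (v : Fin m → Fin 2) (σ : Fin m → Permutation′ m) → ∃ (F π) → Fin 2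
      Inc v σ (i , i∈F) =
        (1 ℕ.+ bit i∈F ℕ.+ toℕ (v i) ℕ.+ length (L₀-list except i)
           ℕ.+ sum (map (λ j → χ (σ j ⟨$⟩ʳ (π ⟨$⟩ʳ j)) (σ j ⟨$⟩ʳ i))
                             (filter (¬? ∘ F? π) (allFin m))))
        mod 2

    -- Points are counted up to pointwise _≈_.
    HasCardinality : ∀ {p} → Pred (Point m) p → ℕ → Set (c ⊔ ℓ₁ ⊔ p)
    HasCardinality P n =
      Inverse (On.setoid (VecEq.≋-setoid setoid m) (proj₁ {B = P})) (≡.setoid (Fin n))

{-# OPTIONS --safe #-}

-- At γ ∈ EC(π), for i ∈ F(π), every factor of λⁱ is nonzero and the associated
-- permutations record its sign, so the sign of λⁱ is given by the parity of
-- vᵢ + |L₀ ∖ {i}| + ∑ χ; for i ∉ F(π) the factor indexed by π⁻¹(i) vanishes.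
-- Whatever the value of γⁱ, this makes Inc(γ, i) the parity of (vᵢ + ∑ χ) + |L₀|.
-- Only |L₀| depends on γ, and toggling one fixed coordinate i₀ ∈ F(π) changes its
-- parity. Hence, if the parity of vᵢ + ∑ χ is constant on F(π), the equilibria
-- are parametrised by the free choice of the coordinates in F(π) ∖ {i₀}, and
-- otherwise there are none.
module Submission where

open import Defs
open import Algebra.Bundles using (CommutativeRing)
import Algebra.Properties.Ring as RingProperties
open import Data.Bool.Base using (if_then_else_)
open import Data.Empty using (⊥-elim)
open import Data.Nat.Base as ℕ using (ℕ; suc; _≤_; _*_; parity)
import Data.Nat.Properties as ℕ
open import Data.Nat.Divisibility using (_∣_; divides)
open import Data.Nat.DivMod using (_mod_)
open import Data.Nat.ListAction using (sum)
import Data.Nat.Solver as NatSolver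
open import Data.Fin.Base as Fin using (Fin; zero; toℕ; funToFin; finToFun; combine; remQuot)
import Data.Fin.Properties as Fin
open import Data.Fin.Permutation using (Permutation′; _⟨$⟩ʳ_; _⟨$⟩ˡ_; inverseʳ)
open import Data.List.Base using (List; []; _∷_; length; filter; map; allFin; lookup)
open import Data.List.Properties using (filter-accept; filter-reject; filter-all; filter-none)
open import Data.List.Membership.Propositional using () renaming (_∈_ to _∈ₗ_; _∉_ to _∉ₗ_)
open import Data.List.Membership.Propositional.Properties using (∈-filter⁺; ∈-filter⁻; ∈-allFin; ∈-lookup)
import Data.List.Relation.Unary.All as All
open import Data.List.Relation.Unary.Any as Any using (here; there)
open import Data.List.Relation.Unary.Any.Properties using (lookup-index)
open import Data.List.Relation.Unary.AllPairs using (_∷_)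
open import Data.List.Relation.Unary.Unique.Propositional using (Unique)
import Data.List.Relation.Unary.Unique.Propositional.Properties as Unique
open import Data.Parity.Base as ℙ using (Parity; 0ℙ; 1ℙ)
import Data.Parity.Properties as ℙ
open import Data.Product.Base using (∃; _×_; _,_; proj₁; proj₂; Σ-syntax; ∃-syntax)
open import Data.Sum.Base using (_⊎_; inj₁; inj₂)
open import Function.Base using (_∘_; const; case_of_)
open import Function.Bundles using (_⇔_; Equivalence; Injection; Inverse; mk⇔)
open import Function.Properties.Inverse using (↔⇒↣)
open import Relation.Binary.Bundles using (Setoid)
open import Relation.Binary.Definitions using (tri<; tri≈; tri>)
open import Relation.Binary.PropositionalEquality.Core as ≡ using (_≡_; _≢_; _≗_)
import Relation.Binary.PropositionalEquality.Properties as ≡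
open import Relation.Binary.Structures using (IsStrictPartialOrder)
open import Relation.Nullary using (¬_; Dec; yes; no; does; ¬?)
open import Relation.Nullary.Decidable using (dec-true; dec-false; _→-dec_)
open import Relation.Unary using (Pred; Decidable; _∈_; _∩_)

-- Parities of natural numbers and residues modulo 2.

fromParity : Parity → Fin 2
fromParity 0ℙ = zero
fromParity 1ℙ = Fin.suc zero

fromParity-injective : ∀ {p q} → fromParity p ≡ fromParity q → p ≡ q
fromParity-injective {0ℙ} {0ℙ} _ = ≡.refl
fromParity-injective {1ℙ} {1ℙ} _ = ≡.refl

mod2≡fromParity : ∀ n → n mod 2 ≡ fromParity (parity n)
mod2≡fromParity 0             = ≡.refl
mod2≡fromParity 1             = ≡.refl
mod2≡fromParity (suc (suc n)) = mod2≡fromParity n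

parity-suc : ∀ n → parity (suc n) ≡ parity n ℙ.⁻¹
parity-suc n = ≡.trans (≡.sym (ℙ.⁻¹-involutive _)) (≡.cong ℙ._⁻¹ (ℙ.suc-homo-⁻¹ n))

parity≡0⇒2∣ : ∀ n → parity n ≡ 0ℙ → 2 ∣ n
parity≡0⇒2∣ 0             _  = divides 0 ≡.refl
parity≡0⇒2∣ (suc (suc n)) eq with parity≡0⇒2∣ n eq
... | divides q ≡.refl = divides (suc q) ≡.refl

2∣⇒parity≡0 : ∀ {n} → 2 ∣ n → parity n ≡ 0ℙ
2∣⇒parity≡0 (divides 0       ≡.refl) = ≡.refl
2∣⇒parity≡0 (divides (suc q) ≡.refl) = 2∣⇒parity≡0 (divides q ≡.refl)

parity-+≡0⇒≡ : ∀ m n → parity (m ℕ.+ n) ≡ 0ℙ → parity m ≡ parity n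
parity-+≡0⇒≡ m n eq with parity m | parity n | ≡.trans (≡.sym (ℙ.+-homo-+ m n)) eq
... | 0ℙ | 0ℙ | _ = ≡.refl
... | 1ℙ | 1ℙ | _ = ≡.refl

≡⇒parity-+≡0 : ∀ m n → parity m ≡ parity n → parity (m ℕ.+ n) ≡ 0ℙ
≡⇒parity-+≡0 m n eq =
  ≡.trans (ℙ.+-homo-+ m n) (≡.trans (≡.cong (ℙ._+ parity n) eq) (ℙ.p+p≡0ℙ (parity n)))

parity-+-even : ∀ m n → parity n ≡ 0ℙ → parity (m ℕ.+ n) ≡ parity m
parity-+-even m n even = ≡.trans (ℙ.+-homo-+ m n)
  (≡.trans (≡.cong (parity m ℙ.+_) even) (ℙ.+-identityʳ (parity m)))

parity-+-odd : ∀ m n → parity n ≡ 1ℙ → parity (m ℕ.+ n) ≡ parity m ℙ.⁻¹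
parity-+-odd m n odd = ≡.trans (ℙ.+-homo-+ m n)
  (≡.trans (≡.cong (parity m ℙ.+_) odd) (ℙ.+-comm (parity m) 1ℙ))

suc-fromParity-mod2 : ∀ p → suc (toℕ (fromParity p)) mod 2 ≡ fromParity (p ℙ.⁻¹)
suc-fromParity-mod2 0ℙ = ≡.refl
suc-fromParity-mod2 1ℙ = ≡.refl

≢⇒⁻¹≡ : ∀ {p q} → p ≢ q → p ℙ.⁻¹ ≡ q
≢⇒⁻¹≡ {0ℙ} {0ℙ} p≢q = ⊥-elim (p≢q ≡.refl)
≢⇒⁻¹≡ {0ℙ} {1ℙ} _   = ≡.refl
≢⇒⁻¹≡ {1ℙ} {0ℙ} _   = ≡.refl
≢⇒⁻¹≡ {1ℙ} {1ℙ} p≢q = ⊥-elim (p≢q ≡.refl)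

-- Positions in lists, finite functions and bijections.

index-∈-lookup : ∀ {a} {A : Set a} {xs : List A} → Unique xs →
                 ∀ k (p : lookup xs k ∈ₗ xs) → Any.index p ≡ k
index-∈-lookup {xs = _ ∷ _} _        zero        (here _)  = ≡.refl
index-∈-lookup {xs = _ ∷ _} (x∉ ∷ _) zero        (there p) =
  ⊥-elim (All.lookup x∉ p ≡.refl)
index-∈-lookup {xs = _ ∷ _} (x∉ ∷ _) (Fin.suc k) (here eq) =
  ⊥-elim (All.lookup x∉ (∈-lookup k) (≡.sym eq))
index-∈-lookup {xs = _ ∷ _} (_ ∷ u)  (Fin.suc k) (there p) =
  ≡.cong Fin.suc (index-∈-lookup u k p)

funToFin-cong : ∀ {m n} {f g : Fin m → Fin n} → f ≗ g → funToFin f ≡ funToFin g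
funToFin-cong {ℕ.zero} _   = ≡.refl
funToFin-cong {suc m}  f≗g = ≡.cong₂ combine (f≗g zero) (funToFin-cong (f≗g ∘ Fin.suc))

-- A section of an injective map is also a retraction, because `to (from (to x)) ≡ to x` already
-- gives `from (to x) ≈ x`. Counting points thus never requires comparing a point with its
-- reconstruction coordinate by coordinate.
injection∧section⇒inverse : ∀ {c ℓ b} (S : Setoid c ℓ) {B : Set b} → let open Setoid S in
  (to : Carrier → B) → (∀ {x y} → x ≈ y → to x ≡ to y) → (∀ {x y} → to x ≡ to y → x ≈ y) →
  (from : B → Carrier) → (∀ b → to (from b) ≡ b) → Inverse S (≡.setoid B)
injection∧section⇒inverse S to cong inj from to∘from = record
  { to        = to
  ; from      = from
  ; to-cong   = cong
  ; from-cong = λ { ≡.refl → refl }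
  ; inverse   = (λ y≈ → ≡.trans (cong y≈) (to∘from _))
              , (λ { ≡.refl → inj (to∘from _) })
  }
  where open Setoid S

module _ {c ℓ₁ ℓ₂ ℓ₃} (R : RealNumbers c ℓ₁ ℓ₂ ℓ₃) where

  open RealNumbers R hiding (zero) renaming (_*_ to _∗_; _≤_ to _≤ᵣ_)
  open Games R
  open IsStrictPartialOrder isStrictPartialOrder
    using (<-respʳ-≈; <-respˡ-≈; irrefl; asym)
  open RingProperties (CommutativeRing.ring commutativeRing)

  -- Signs of products in an ordered field.

  x<0⇒0<-x : ∀ {x} → x < 0# → 0# < - x
  x<0⇒0<-x {x} x<0 =
    <-respˡ-≈ (-‿inverseʳ x) (<-respʳ-≈ (+-identityˡ (- x)) (+-monoˡ-< (- x) x<0))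

  0<-x⇒x<0 : ∀ {x} → 0# < - x → x < 0#
  0<-x⇒x<0 {x} 0<-x =
    <-respʳ-≈ (-‿inverseˡ x) (<-respˡ-≈ (+-identityˡ x) (+-monoˡ-< x 0<-x))

  0<x⇒-x<0 : ∀ {x} → 0# < x → - x < 0#
  0<x⇒-x<0 0<x = 0<-x⇒x<0 (<-respʳ-≈ (sym (-‿involutive _)) 0<x)

  x<y⇒0<y-x : ∀ {x y} → x < y → 0# < y - x
  x<y⇒0<y-x {x} x<y = <-respˡ-≈ (-‿inverseʳ x) (+-monoˡ-< (- x) x<y)

  x<y⇒x-y<0 : ∀ {x y} → x < y → x - y < 0#
  x<y⇒x-y<0 {y = y} x<y = <-respʳ-≈ (-‿inverseʳ y) (+-monoˡ-< (- y) x<y)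

  neg*pos : ∀ {x y} → x < 0# → 0# < y → x ∗ y < 0#
  neg*pos {x} {y} x<0 0<y =
    0<-x⇒x<0 (<-respʳ-≈ (sym (-‿distribˡ-* x y)) (*-pos (x<0⇒0<-x x<0) 0<y))

  pos*neg : ∀ {x y} → 0# < x → y < 0# → x ∗ y < 0#
  pos*neg 0<x y<0 = <-respˡ-≈ (*-comm _ _) (neg*pos y<0 0<x)

  neg*neg : ∀ {x y} → x < 0# → y < 0# → 0# < x ∗ y
  neg*neg {x} {y} x<0 y<0 =
    <-respʳ-≈ -x*-y≈x*y (*-pos (x<0⇒0<-x x<0) (x<0⇒0<-x y<0))
    where
    -x*-y≈x*y : - x ∗ - y ≈ x ∗ y
    -x*-y≈x*y = trans (sym (-‿distribˡ-* x (- y)))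
               (trans (-‿cong (sym (-‿distribʳ-* x y))) (-‿involutive _))

  -- Says that `x` has the strict sign of the `n`-th power of -1. Recursion in steps of two makes an
  -- even shift of `n` hold by definition, so negative factors can be counted in ℕ without reducing
  -- modulo 2.
  Sign : ℕ → Carrier → Set ℓ₃
  Sign 0             x = 0# < x
  Sign 1             x = x < 0#
  Sign (suc (suc n)) x = Sign n x

  Sign-resp-≈ : ∀ n {x y} → x ≈ y → Sign n x → Sign n y
  Sign-resp-≈ 0             = <-respʳ-≈
  Sign-resp-≈ 1             = <-respˡ-≈
  Sign-resp-≈ (suc (suc n)) = Sign-resp-≈ n

  Sign-pos* : ∀ n {x y} → 0# < x → Sign n y → Sign n (x ∗ y)
  Sign-pos* 0             = *-pos
  Sign-pos* 1             = pos*neg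
  Sign-pos* (suc (suc n)) = Sign-pos* n

  Sign-neg* : ∀ n {x y} → x < 0# → Sign n y → Sign (suc n) (x ∗ y)
  Sign-neg* 0             = neg*pos
  Sign-neg* 1             = neg*neg
  Sign-neg* (suc (suc n)) = Sign-neg* n

  Sign-[-1]^* : ∀ k n {x} → Sign n x → Sign (k ℕ.+ n) ((- 1#) ^ k ∗ x)
  Sign-[-1]^* 0       n s = Sign-resp-≈ n (sym (*-identityˡ _)) s
  Sign-[-1]^* (suc k) n s = Sign-resp-≈ (suc (k ℕ.+ n)) (sym (*-assoc _ _ _))
    (Sign-neg* (k ℕ.+ n) (0<x⇒-x<0 0<1) (Sign-[-1]^* k n s))

  -- A weak inequality is the negation of the opposite strict one, so it refutes the wrong sign
  -- without deciding the order. This lemma and the next three translate between the equilibrium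
  -- inequalities and parities.
  Sign∧≥0⇒even : ∀ n {x} → Sign n x → 0# ≤ᵣ x → parity n ≡ 0ℙ
  Sign∧≥0⇒even 0             _ _   = ≡.refl
  Sign∧≥0⇒even 1             s 0≤x = ⊥-elim (0≤x s)
  Sign∧≥0⇒even (suc (suc n))       = Sign∧≥0⇒even n

  Sign∧≤0⇒odd : ∀ n {x} → Sign n x → x ≤ᵣ 0# → parity (suc n) ≡ 0ℙ
  Sign∧≤0⇒odd 0             s x≤0 = ⊥-elim (x≤0 s)
  Sign∧≤0⇒odd 1             _ _   = ≡.refl
  Sign∧≤0⇒odd (suc (suc n))       = Sign∧≤0⇒odd n

  even∧Sign⇒≥0 : ∀ n {x} → Sign n x → parity n ≡ 0ℙ → 0# ≤ᵣ x
  even∧Sign⇒≥0 0             0<x _ = asym 0<x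
  even∧Sign⇒≥0 (suc (suc n))       = even∧Sign⇒≥0 n

  odd∧Sign⇒≤0 : ∀ n {x} → Sign n x → parity (suc n) ≡ 0ℙ → x ≤ᵣ 0#
  odd∧Sign⇒≤0 1             x<0 _ = asym x<0
  odd∧Sign⇒≤0 (suc (suc n))       = odd∧Sign⇒≤0 n

  ∏-zero : ∀ {a} {A : Set a} {xs : List A} {x} (f : A → Carrier) →
           x ∈ₗ xs → f x ≈ 0# → ∏ xs f ≈ 0#
  ∏-zero f (here ≡.refl) fx≈0 = trans (*-congʳ fx≈0) (zeroˡ _)
  ∏-zero f (there x∈xs)  fx≈0 = trans (*-congˡ (∏-zero f x∈xs fx≈0)) (zeroʳ _)

  ≈⇒≤ : ∀ {x y} → x ≈ y → x ≤ᵣ y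
  ≈⇒≤ x≈y y<x = irrefl (sym x≈y) y<x

  module _ {m : ℕ} where

    -- Deleting a player from a list, and values of `χ`.

    module _ {i : Fin m} where

      except-accept : ∀ {j} (js : List (Fin m)) → j ≢ i → (j ∷ js) except i ≡ j ∷ (js except i)
      except-accept _ = filter-accept (λ k → ¬? (k Fin.≟ i))

      except-reject : ∀ {j} (js : List (Fin m)) → j ≡ i → (j ∷ js) except i ≡ js except i
      except-reject _ j≡i = filter-reject (λ k → ¬? (k Fin.≟ i)) (λ j≢i → j≢i j≡i)

      ∉⇒except≡ : ∀ {xs} → i ∉ₗ xs → xs except i ≡ xs
      ∉⇒except≡ i∉xs = filter-all (λ k → ¬? (k Fin.≟ i))
        (All.tabulate λ { j∈xs ≡.refl → i∉xs j∈xs })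

      ∈⇒length≡suc-except : ∀ {xs} → Unique xs → i ∈ₗ xs → length xs ≡ suc (length (xs except i))
      ∈⇒length≡suc-except {x ∷ xs} (x∉ ∷ _) (here ≡.refl) = ≡.cong suc (≡.cong length (≡.sym
        (≡.trans (except-reject xs ≡.refl) (∉⇒except≡ λ i∈ → All.lookup x∉ i∈ ≡.refl))))
      ∈⇒length≡suc-except {x ∷ xs} (x∉ ∷ u) (there i∈xs) = ≡.trans
        (≡.cong suc (∈⇒length≡suc-except u i∈xs))
        (≡.cong (suc ∘ length) (≡.sym (except-accept xs (All.lookup x∉ i∈xs))))

      -- Agreement away from `i` is enough, since `i` is deleted on both sides. This serves to
      -- compare the zero sets of two points that differ only at `i`.
      filter-except-cong : ∀ {p q} {P : Pred (Fin m) p} {Q : Pred (Fin m) q}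
        (P? : Decidable P) (Q? : Decidable Q) →
        (∀ {j} → j ≢ i → P j → Q j) → (∀ {j} → j ≢ i → Q j → P j) →
        ∀ xs → filter P? xs except i ≡ filter Q? xs except i
      filter-except-cong P? Q? P⇒Q Q⇒P [] = ≡.refl
      filter-except-cong P? Q? P⇒Q Q⇒P (x ∷ xs)
        with ih ← filter-except-cong P? Q? P⇒Q Q⇒P xs | x Fin.≟ i | P? x | Q? x
      ... | yes x≡i | yes _  | yes _  = ≡.trans (except-reject _ x≡i)
        (≡.trans ih (≡.sym (except-reject _ x≡i)))
      ... | yes x≡i | yes _  | no _   = ≡.trans (except-reject _ x≡i) ih
      ... | yes x≡i | no _   | yes _  = ≡.trans ih (≡.sym (except-reject _ x≡i))
      ... | _       | no _   | no _   = ih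
      ... | no x≢i  | yes _  | yes _  = ≡.trans (except-accept _ x≢i)
        (≡.trans (≡.cong (x ∷_) ih) (≡.sym (except-accept _ x≢i)))
      ... | no x≢i  | yes px | no ¬qx = ⊥-elim (¬qx (P⇒Q x≢i px))
      ... | no x≢i  | no ¬px | yes qx = ⊥-elim (¬px (Q⇒P x≢i qx))

    χ≡1 : ∀ {k l : Fin m} → l Fin.< k → χ k l ≡ 1
    χ≡1 {k} {l} l<k rewrite dec-true (l Fin.≤? k) (ℕ.<⇒≤ l<k) = ≡.refl

    χ≡0 : ∀ {k l : Fin m} → k Fin.< l → χ k l ≡ 0
    χ≡0 {k} {l} k<l rewrite dec-false (l Fin.≤? k) (ℕ.<⇒≱ k<l) = ≡.refl

    -- Points of EC(π) and their binary coordinates.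

    value : Fin 2 → Carrier
    value zero        = 0#
    value (Fin.suc _) = 1#

    0≤value≤1 : ∀ x → (0# ≤ᵣ value x) × (value x ≤ᵣ 1#)
    0≤value≤1 zero        = ≈⇒≤ refl , asym 0<1
    0≤value≤1 (Fin.suc _) = asym 0<1 , ≈⇒≤ refl

    value-injective : ∀ {x y} → value x ≈ value y → x ≡ y
    value-injective {zero}         {zero}         _  = ≡.refl
    value-injective {zero}         {Fin.suc zero} eq = ⊥-elim (0≉1 eq)
    value-injective {Fin.suc zero} {zero}         eq = ⊥-elim (0≉1 (sym eq))
    value-injective {Fin.suc zero} {Fin.suc zero} _  = ≡.refl

    module _ {a : Fin m → Fin m → Carrier} {π : Permutation′ m} where

      fixedValue : ∀ {γ i} → γ ∈ EC a π → i ∈ F π → i ∈ L γ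
      fixedValue {i = i} γ∈EC = Equivalence.from (EC.L≐F γ∈EC i)

      L₀-list-unique : ∀ {γ} (γ∈EC : γ ∈ EC a π) → Unique (L₀-list γ∈EC)
      L₀-list-unique γ∈EC = Unique.filter⁺ (L₀? γ∈EC) (Unique.allFin⁺ m)

      γi≈0⇒|L₀|≡suc : ∀ {γ i} (γ∈EC : γ ∈ EC a π) → γ i ≈ 0# →
        length (L₀-list γ∈EC) ≡ suc (length (L₀-list γ∈EC except i))
      γi≈0⇒|L₀|≡suc γ∈EC γi≈0 = ∈⇒length≡suc-except (L₀-list-unique γ∈EC)
        (∈-filter⁺ (L₀? γ∈EC) (∈-allFin _) γi≈0)

      γi≈1⇒|L₀|≡ : ∀ {γ i} (γ∈EC : γ ∈ EC a π) → γ i ≈ 1# →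
        length (L₀-list γ∈EC) ≡ length (L₀-list γ∈EC except i)
      γi≈1⇒|L₀|≡ γ∈EC γi≈1 = ≡.cong length (≡.sym (∉⇒except≡ λ i∈L₀ →
        0≉1 (trans (sym (proj₂ (∈-filter⁻ (L₀? γ∈EC) {xs = allFin m} i∈L₀))) γi≈1)))

      -- The two zero sets coincide once `i` is deleted, and only that of `γ` contains `i`.
      |L₀|-toggle : ∀ {γ γ′ i} (γ∈EC : γ ∈ EC a π) (γ′∈EC : γ′ ∈ EC a π) →
        (∀ {j} → j ≢ i → γ j ≈ γ′ j) → γ i ≈ 0# → γ′ i ≈ 1# →
        length (L₀-list γ∈EC) ≡ suc (length (L₀-list γ′∈EC))
      |L₀|-toggle {i = i} γ∈EC γ′∈EC γ≈γ′ γi≈0 γ′i≈1 = begin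
        length (L₀-list γ∈EC)                  ≡⟨ γi≈0⇒|L₀|≡suc γ∈EC γi≈0 ⟩
        suc (length (L₀-list γ∈EC except i))   ≡⟨ ≡.cong (suc ∘ length)
                                                    (filter-except-cong (L₀? γ∈EC) (L₀? γ′∈EC)
                                                      (λ j≢i → trans (sym (γ≈γ′ j≢i)))
                                                      (λ j≢i → trans (γ≈γ′ j≢i)) (allFin m)) ⟩
        suc (length (L₀-list γ′∈EC except i))  ≡⟨ ≡.cong suc (γi≈1⇒|L₀|≡ γ′∈EC γ′i≈1) ⟨
        suc (length (L₀-list γ′∈EC))           ∎
        where open ≡.≡-Reasoning

      bit-cases : ∀ {γ i} (γ∈EC : γ ∈ EC a π) (i∈F : i ∈ F π) →
        (γ i ≈ 0# × bit γ∈EC i∈F ≡ 0) ⊎ (γ i ≈ 1# × bit γ∈EC i∈F ≡ 1)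
      bit-cases {i = i} γ∈EC i∈F with Equivalence.from (EC.L≐F γ∈EC i) i∈F
      ... | inj₁ γi≈0 = inj₁ (γi≈0 , ≡.refl)
      ... | inj₂ γi≈1 = inj₂ (γi≈1 , ≡.refl)

      -- Defined for all players, so that no proof of `i ∈ F π` enters; off F(π) the result is
      -- always 1 and carries no information.
      bits : ∀ {γ} → γ ∈ EC a π → Fin m → Fin 2
      bits γ∈EC i with L₀? γ∈EC i
      ... | yes _ = zero
      ... | no  _ = Fin.suc zero

      value-bits : ∀ {γ i} (γ∈EC : γ ∈ EC a π) → i ∈ F π → γ i ≈ value (bits γ∈EC i)
      value-bits {i = i} γ∈EC i∈F with L₀? γ∈EC i
      ... | yes γi≈0 = γi≈0
      ... | no  γi≉0 with fixedValue γ∈EC i∈F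
      ...   | inj₁ γi≈0 = ⊥-elim (γi≉0 γi≈0)
      ...   | inj₂ γi≈1 = γi≈1

      -- On F(π) the bit depends on the coordinate alone and not on the proof `γ∈EC`, because 0 and
      -- 1 are distinct.
      bits-unique : ∀ {γ i x} (γ∈EC : γ ∈ EC a π) → i ∈ F π → γ i ≈ value x → bits γ∈EC i ≡ x
      bits-unique γ∈EC i∈F γi≈x = value-injective (trans (sym (value-bits γ∈EC i∈F)) γi≈x)

      bits≡⇒≈ : ∀ {γ γ′} (γ∈EC : γ ∈ EC a π) (γ′∈EC : γ′ ∈ EC a π) {i} →
        (i ∈ F π → bits γ∈EC i ≡ bits γ′∈EC i) → γ i ≈ γ′ i
      bits≡⇒≈ γ∈EC γ′∈EC {i} eq = case F? π i of λ where
        (no  i∉F) → trans (EC.off-F γ∈EC i i∉F) (sym (EC.off-F γ′∈EC i i∉F))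
        (yes i∈F) → trans (value-bits γ∈EC i∈F)
          (trans (reflexive (≡.cong value (eq i∈F))) (sym (value-bits γ′∈EC i∈F)))

      ≈⇒bits≡ : ∀ {γ γ′} (γ∈EC : γ ∈ EC a π) (γ′∈EC : γ′ ∈ EC a π) {i} → i ∈ F π →
        γ i ≈ γ′ i → bits γ∈EC i ≡ bits γ′∈EC i
      ≈⇒bits≡ γ∈EC γ′∈EC i∈F γi≈ =
        bits-unique γ∈EC i∈F (trans γi≈ (value-bits γ′∈EC i∈F))

      -- If the coordinates at `i` differed, the zero sets would differ in size by exactly one, and
      -- so in parity.
      |L₀|-parity-injective : ∀ {γ γ′ i} (γ∈EC : γ ∈ EC a π) (γ′∈EC : γ′ ∈ EC a π) → i ∈ F π →
        (∀ {j} → j ≢ i → γ j ≈ γ′ j) →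
        parity (length (L₀-list γ∈EC)) ≡ parity (length (L₀-list γ′∈EC)) → γ i ≈ γ′ i
      |L₀|-parity-injective γ∈EC γ′∈EC i∈F γ≈γ′ eq
        with fixedValue γ∈EC i∈F | fixedValue γ′∈EC i∈F
      ... | inj₁ γi≈0 | inj₁ γ′i≈0 = trans γi≈0 (sym γ′i≈0)
      ... | inj₂ γi≈1 | inj₂ γ′i≈1 = trans γi≈1 (sym γ′i≈1)
      ... | inj₁ γi≈0 | inj₂ γ′i≈1 = ⊥-elim (ℙ.p≢p⁻¹ _ (≡.trans (≡.sym eq) (≡.trans
        (≡.cong parity (|L₀|-toggle γ∈EC γ′∈EC γ≈γ′ γi≈0 γ′i≈1)) (parity-suc (length (L₀-list γ′∈EC))))))
      ... | inj₂ γi≈1 | inj₁ γ′i≈0 = ⊥-elim (ℙ.p≢p⁻¹ _ (≡.trans eq (≡.trans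
        (≡.cong parity (|L₀|-toggle γ′∈EC γ∈EC (sym ∘ γ≈γ′) γ′i≈0 γi≈1)) (parity-suc (length (L₀-list γ∈EC))))))

    -- The sign of the gain at a point of EC(π).

    module ProductGame {U : TwoActionGame m} {v : Fin m → Fin 2} {a : Fin m → Fin m → Carrier}
             (isProductGame : IsProductGame U v a)
             (σ : Fin m → Permutation′ m) (σ-assoc : ∀ j → IsAssociatedPermutation a j (σ j))
             (π : Permutation′ m) where

      open IsProductGame isProductGame

      πj≢i : ∀ {i j} → i ∈ F π → j ≢ i → π ⟨$⟩ʳ j ≢ i
      πj≢i i∈F j≢i πj≡i = j≢i (Injection.injective (↔⇒↣ π) (≡.trans πj≡i (≡.sym i∈F)))

      χ-at : Fin m → Fin m → ℕ
      χ-at i j = χ (σ j ⟨$⟩ʳ (π ⟨$⟩ʳ j)) (σ j ⟨$⟩ʳ i)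

      χ-sum : Fin m → List (Fin m) → ℕ
      χ-sum i js = sum (map (χ-at i) (filter (¬? ∘ F? π) js))

      -- The part of Inc(γ , i) that does not depend on γ.
      weight : Fin m → ℕ
      weight i = toℕ (v i) ℕ.+ χ-sum i (allFin m)

      module _ {γ : Point m} (γ∈EC : γ ∈ EC a π) where

        open EC γ∈EC

        |L₀| : ℕ
        |L₀| = length (L₀-list γ∈EC)

        -- Here `γ j` is `a (π ⟨$⟩ʳ j) j`, and `σ j` lists the numbers `a _ j` in decreasing order.
        -- So `χ-at i j` is 1 exactly when `a i j` is the larger of the two, that is, when the
        -- factor is negative.
        factor-χ : ∀ {i j} → i ∈ F π → ¬ (j ∈ F π) →
          (0# < γ j - a i j × χ-at i j ≡ 0) ⊎ (γ j - a i j < 0# × χ-at i j ≡ 1)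
        factor-χ {i} {j} i∈F j∉F
          with Fin.<-cmp (σ j ⟨$⟩ʳ (π ⟨$⟩ʳ j)) (σ j ⟨$⟩ʳ i) | j≢i
          where
          j≢i : j ≢ i
          j≢i ≡.refl = j∉F i∈F
        ... | tri< lt _ _ | j≢i = inj₁
          ( x<y⇒0<y-x (<-respʳ-≈ (sym (off-F j j∉F))
              (Equivalence.to (proj₂ (σ-assoc j) _ i j∉F (j≢i ∘ ≡.sym)) lt))
          , χ≡0 lt)
        -- A tie would give π(j) = i, although `i` is already the image of itself and differs from
        -- `j`.
        ... | tri≈ _ eq _ | j≢i = ⊥-elim (πj≢i i∈F j≢i (Injection.injective (↔⇒↣ (σ j)) eq))
        ... | tri> _ _ gt | j≢i = inj₂
          ( x<y⇒x-y<0 (<-respˡ-≈ (sym (off-F j j∉F))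
              (Equivalence.to (proj₂ (σ-assoc j) i _ (j≢i ∘ ≡.sym) j∉F) gt))
          , χ≡1 gt)

        -- Stated for an arbitrary list to allow induction. Since every `a i j` with `j ≢ i` lies
        -- strictly between 0 and 1, a coordinate 0 gives a negative factor and a coordinate 1 a
        -- positive one; a player off F(π) contributes its `χ`, and `i` itself contributes nothing.
        ∏-Sign : ∀ {i} → i ∈ F π → ∀ js →
          Sign (length (filter (L₀? γ∈EC) js except i) ℕ.+ χ-sum i js)
               (∏ (js except i) (λ j → γ j - a i j))
        ∏-Sign i∈F [] = 0<1
        ∏-Sign {i} i∈F (j ∷ js) = step (j Fin.≟ i) (F? π j)
          where
          n = length (filter (L₀? γ∈EC) js except i)

          ih : Sign (n ℕ.+ χ-sum i js) (∏ (js except i) (λ j → γ j - a i j))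
          ih = ∏-Sign i∈F js

          Goal = Sign (length (filter (L₀? γ∈EC) (j ∷ js) except i) ℕ.+ χ-sum i (j ∷ js))
                      (∏ ((j ∷ js) except i) (λ j → γ j - a i j))

          step : Dec (j ≡ i) → Dec (j ∈ F π) → Goal
          step (yes ≡.refl) (no j∉F) = ⊥-elim (j∉F i∈F)
          step (yes j≡i) (yes j∈F) with fixedValue γ∈EC j∈F
          ... | inj₁ γj≈0
            rewrite filter-reject (¬? ∘ F? π) {xs = js} (λ j∉F → j∉F j∈F)
                  | filter-accept (L₀? γ∈EC) {xs = js} γj≈0
                  | except-reject (filter (L₀? γ∈EC) js) j≡i
                  | except-reject js j≡i = ih
          ... | inj₂ γj≈1
            rewrite filter-reject (¬? ∘ F? π) {xs = js} (λ j∉F → j∉F j∈F)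
                  | filter-reject (L₀? γ∈EC) {xs = js} (λ γj≈0 → 0≉1 (trans (sym γj≈0) γj≈1))
                  | except-reject js j≡i = ih
          step (no j≢i) (yes j∈F) with fixedValue γ∈EC j∈F
          ... | inj₁ γj≈0
            rewrite filter-reject (¬? ∘ F? π) {xs = js} (λ j∉F → j∉F j∈F)
                  | filter-accept (L₀? γ∈EC) {xs = js} γj≈0
                  | except-accept (filter (L₀? γ∈EC) js) j≢i
                  | except-accept js j≢i =
            Sign-neg* (n ℕ.+ χ-sum i js)
              (x<y⇒x-y<0 (<-respˡ-≈ (sym γj≈0) (proj₁ (a-in-unit i j (j≢i ∘ ≡.sym))))) ih
          ... | inj₂ γj≈1
            rewrite filter-reject (¬? ∘ F? π) {xs = js} (λ j∉F → j∉F j∈F)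
                  | filter-reject (L₀? γ∈EC) {xs = js} (λ γj≈0 → 0≉1 (trans (sym γj≈0) γj≈1))
                  | except-accept js j≢i =
            Sign-pos* (n ℕ.+ χ-sum i js)
              (x<y⇒0<y-x (<-respʳ-≈ (sym γj≈1) (proj₂ (a-in-unit i j (j≢i ∘ ≡.sym))))) ih
          step (no j≢i) (no j∉F)
            rewrite filter-accept (¬? ∘ F? π) {xs = js} j∉F
                  | filter-reject (L₀? γ∈EC) {xs = js} (j∉F ∘ Equivalence.to (L≐F j) ∘ inj₁)
                  | except-accept js j≢i with factor-χ i∈F j∉F
          ... | inj₁ (pos , χ≡) rewrite χ≡ = Sign-pos* (n ℕ.+ χ-sum i js) pos ih
          ... | inj₂ (neg , χ≡) rewrite χ≡ | ℕ.+-suc n (χ-sum i js) =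
            Sign-neg* (n ℕ.+ χ-sum i js) neg ih

        gain-exponent : Fin m → ℕ
        gain-exponent i = toℕ (v i) ℕ.+ (length (L₀-list γ∈EC except i) ℕ.+ χ-sum i (allFin m))

        gain-Sign : ∀ {i} → i ∈ F π → Sign (gain-exponent i) (gain U i γ)
        gain-Sign {i} i∈F = Sign-resp-≈ (gain-exponent i) (sym (gain≈ i γ inUnitCube))
          (Sign-[-1]^* (toℕ (v i)) _ (∏-Sign i∈F (allFin m)))

        gain-zero : ∀ {i} → ¬ (i ∈ F π) → gain U i γ ≈ 0#
        gain-zero {i} i∉F = trans (gain≈ i γ inUnitCube) (trans (*-congˡ
          (∏-zero (λ j → γ j - a i j) (∈-filter⁺ (λ j → ¬? (j Fin.≟ i)) (∈-allFin k) k≢i) factor≈0))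
          (zeroʳ _))
          where
          -- As `k` is not fixed and π(k) = i, the coordinate `γ k` equals `a i k`, which kills the
          -- factor at `k`.
          k = π ⟨$⟩ˡ i

          πk≡i : π ⟨$⟩ʳ k ≡ i
          πk≡i = inverseʳ π

          k≢i : k ≢ i
          k≢i k≡i = i∉F (≡.trans (≡.cong (π ⟨$⟩ʳ_) (≡.sym k≡i)) πk≡i)

          factor≈0 : γ k - a i k ≈ 0#
          factor≈0 = trans (+-congʳ (trans (off-F k λ k∈F → k≢i (≡.trans (≡.sym k∈F) πk≡i))
            (reflexive (≡.cong (λ l → a l k) πk≡i)))) (-‿inverseʳ _)

        -- `|L₀|` counts `i` while the exponent of the gain does not. This shift by one matches the
        -- reversal of the equilibrium inequality between coordinates 0 and 1, so both cases ask for
        -- the same parity of `weight i ℕ.+ |L₀|`.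
        γi≈0⇒weight : ∀ {i} → γ i ≈ 0# → weight i ℕ.+ |L₀| ≡ suc (gain-exponent i)
        γi≈0⇒weight {i} γi≈0 rewrite γi≈0⇒|L₀|≡suc γ∈EC γi≈0 =
          solve 3 (λ x s l → x :+ s :+ (con 1 :+ l) := con 1 :+ (x :+ (l :+ s))) ≡.refl
            (toℕ (v i)) (χ-sum i (allFin m)) (length (L₀-list γ∈EC except i))
          where open NatSolver.+-*-Solver

        γi≈1⇒weight : ∀ {i} → γ i ≈ 1# → weight i ℕ.+ |L₀| ≡ gain-exponent i
        γi≈1⇒weight {i} γi≈1 rewrite γi≈1⇒|L₀|≡ γ∈EC γi≈1 =
          solve 3 (λ x s l → x :+ s :+ l := x :+ (l :+ s)) ≡.refl
            (toℕ (v i)) (χ-sum i (allFin m)) (length (L₀-list γ∈EC except i))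
          where open NatSolver.+-*-Solver

        -- If the coordinate is 0, the leading 1 of `Inc` stands for the deleted entry `i` of the
        -- zero set; if it is 1, the leading 1 and the bit add up to 2 and vanish modulo 2.
        Inc≡ : ∀ i → Inc γ∈EC v σ i ≡ fromParity (parity (weight (proj₁ i) ℕ.+ |L₀|))
        Inc≡ (i , i∈F) with bit-cases γ∈EC i∈F
        ... | inj₁ (γi≈0 , bit≡0) rewrite bit≡0 | γi≈0⇒weight γi≈0 =
          ≡.trans (mod2≡fromParity (suc (toℕ (v i) ℕ.+ length (L₀-list γ∈EC except i) ℕ.+ χ-sum i (allFin m))))
            (≡.cong (fromParity ∘ parity ∘ suc) (ℕ.+-assoc
              (toℕ (v i)) (length (L₀-list γ∈EC except i)) (χ-sum i (allFin m))))
        ... | inj₂ (γi≈1 , bit≡1) rewrite bit≡1 | γi≈1⇒weight γi≈1 =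
          ≡.trans (mod2≡fromParity (toℕ (v i) ℕ.+ length (L₀-list γ∈EC except i) ℕ.+ χ-sum i (allFin m)))
            (≡.cong (fromParity ∘ parity) (ℕ.+-assoc
              (toℕ (v i)) (length (L₀-list γ∈EC except i)) (χ-sum i (allFin m))))

        Nash⇒even : IsNash U γ → ∀ {i} → i ∈ F π → parity (weight i ℕ.+ |L₀|) ≡ 0ℙ
        Nash⇒even nash {i} i∈F with fixedValue γ∈EC i∈F
        ... | inj₁ γi≈0 rewrite γi≈0⇒weight γi≈0 =
          Sign∧≤0⇒odd (gain-exponent i) (gain-Sign i∈F) (IsNash.pure₀ nash i γi≈0)
        ... | inj₂ γi≈1 rewrite γi≈1⇒weight γi≈1 =
          Sign∧≥0⇒even (gain-exponent i) (gain-Sign i∈F) (IsNash.pure₁ nash i γi≈1)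

        even⇒Nash : (∀ {i} → i ∈ F π → parity (weight i ℕ.+ |L₀|) ≡ 0ℙ) → IsNash U γ
        even⇒Nash even = record
          { inUnitCube = inUnitCube
          ; mixed      = λ i 0<γi γi<1 → gain-zero λ i∈F → case fixedValue γ∈EC i∈F of λ where
              (inj₁ γi≈0) → irrefl (sym γi≈0) 0<γi
              (inj₂ γi≈1) → irrefl γi≈1 γi<1
          ; pure₀      = λ i γi≈0 → let i∈F = Equivalence.to (L≐F i) (inj₁ γi≈0) in
              odd∧Sign⇒≤0 (gain-exponent i) (gain-Sign i∈F)
                (≡.trans (≡.cong parity (≡.sym (γi≈0⇒weight γi≈0))) (even i∈F))
          ; pure₁      = λ i γi≈1 → let i∈F = Equivalence.to (L≐F i) (inj₂ γi≈1) in
              even∧Sign⇒≥0 (gain-exponent i) (gain-Sign i∈F)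
                (≡.trans (≡.cong parity (≡.sym (γi≈1⇒weight γi≈1))) (even i∈F))
          }

      -- Equilibria in terms of increments.

      Nash⇔Inc≡0 : ∀ γ (γ∈EC : γ ∈ EC a π) → IsNash U γ ⇔ (∀ i → Inc γ∈EC v σ i ≡ zero)
      Nash⇔Inc≡0 γ γ∈EC = mk⇔
        (λ nash i → ≡.trans (Inc≡ γ∈EC i) (≡.cong fromParity (Nash⇒even γ∈EC nash (proj₂ i))))
        (λ Inc≡0 → even⇒Nash γ∈EC λ {i} i∈F →
          fromParity-injective (≡.trans (≡.sym (Inc≡ γ∈EC (i , i∈F))) (Inc≡0 (i , i∈F))))

      -- Points of EC(π) with prescribed bits.

      vertex : (Fin m → Fin 2) → Point m
      vertex b i = if does (F? π i) then value (b i) else a (π ⟨$⟩ʳ i) i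

      vertex-on-F : ∀ b {i} → i ∈ F π → vertex b i ≡ value (b i)
      vertex-on-F b {i} i∈F rewrite dec-true (F? π i) i∈F = ≡.refl

      vertex-off-F : ∀ b {i} → ¬ (i ∈ F π) → vertex b i ≡ a (π ⟨$⟩ʳ i) i
      vertex-off-F b {i} i∉F rewrite dec-false (F? π i) i∉F = ≡.refl

      vertex∈EC : ∀ b → vertex b ∈ EC a π
      vertex∈EC b = record
        { inUnitCube = inCube
        ; L≐F        = λ i → mk⇔ (L⇒F i) (F⇒L i)
        ; off-F      = λ j j∉F → reflexive (vertex-off-F b j∉F)
        }
        where
        inCube : InUnitCube (vertex b)
        inCube i with F? π i
        ... | yes _   = 0≤value≤1 (b i)
        ... | no  i∉F = asym (proj₁ (a-in-unit _ i i∉F)) , asym (proj₂ (a-in-unit _ i i∉F))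

        L⇒F : ∀ i → i ∈ L (vertex b) → i ∈ F π
        L⇒F i i∈L with F? π i
        ... | yes i∈F = i∈F
        L⇒F i (inj₁ a≈0) | no i∉F = ⊥-elim (irrefl (sym a≈0) (proj₁ (a-in-unit _ i i∉F)))
        L⇒F i (inj₂ a≈1) | no i∉F = ⊥-elim (irrefl a≈1 (proj₂ (a-in-unit _ i i∉F)))

        F⇒L : ∀ i → i ∈ F π → i ∈ L (vertex b)
        F⇒L i i∈F rewrite vertex-on-F b i∈F with b i
        ... | zero      = inj₁ refl
        ... | Fin.suc _ = inj₂ refl

      bits-vertex : ∀ b {i} → i ∈ F π → bits (vertex∈EC b) i ≡ b i
      bits-vertex b i∈F = bits-unique (vertex∈EC b) i∈F (reflexive (vertex-on-F b i∈F))

      g∈EC : g a π ∈ EC a π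
      -- `g a π` is by definition the vertex all of whose bits are 1.
      g∈EC = vertex∈EC (const (Fin.suc zero))

      |L₀|-g : |L₀| g∈EC ≡ 0
      |L₀|-g = ≡.cong length (filter-none (L₀? g∈EC) {xs = allFin m} (All.tabulate λ {i} _ → g≉0 i))
        where
        g≉0 : ∀ i → ¬ (g a π i ≈ 0#)
        g≉0 i with F? π i
        ... | yes _   = 0≉1 ∘ sym
        ... | no  i∉F = λ a≈0 → irrefl (sym a≈0) (proj₁ (a-in-unit _ i i∉F))

      Inc-g≡ : ∀ i → Inc g∈EC v σ i ≡ fromParity (parity (weight (proj₁ i)))
      Inc-g≡ i = ≡.trans (Inc≡ g∈EC i) (≡.cong (fromParity ∘ parity)
        (≡.trans (≡.cong (weight (proj₁ i) ℕ.+_) |L₀|-g) (ℕ.+-identityʳ _)))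

      -- The two values of the increment map.

      module _ {γ} (γ∈EC : γ ∈ EC a π) where

        even⇒Inc≗Inc-g : parity (|L₀| γ∈EC) ≡ 0ℙ → Inc γ∈EC v σ ≗ Inc g∈EC v σ
        even⇒Inc≗Inc-g even i = ≡.trans (Inc≡ γ∈EC i) (≡.trans
          (≡.cong fromParity (parity-+-even (weight (proj₁ i)) (|L₀| γ∈EC) even))
          (≡.sym (Inc-g≡ i)))

        odd⇒Inc≗opposite : parity (|L₀| γ∈EC) ≡ 1ℙ → Inc γ∈EC v σ ≗ opposite (Inc g∈EC v σ)
        odd⇒Inc≗opposite odd i = begin
          Inc γ∈EC v σ i                                   ≡⟨ Inc≡ γ∈EC i ⟩
          fromParity (parity (weight (proj₁ i) ℕ.+ |L₀| γ∈EC))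
            ≡⟨ ≡.cong fromParity (parity-+-odd (weight (proj₁ i)) (|L₀| γ∈EC) odd) ⟩
          fromParity (parity (weight (proj₁ i)) ℙ.⁻¹)       ≡⟨ suc-fromParity-mod2 (parity (weight (proj₁ i))) ⟨
          suc (toℕ (fromParity (parity (weight (proj₁ i))))) mod 2
            ≡⟨ ≡.cong (λ x → suc (toℕ x) mod 2) (Inc-g≡ i) ⟨
          opposite (Inc g∈EC v σ) i                         ∎
          where open ≡.≡-Reasoning

        Inc-g⊎opposite : (Inc γ∈EC v σ ≗ Inc g∈EC v σ) ⊎ (Inc γ∈EC v σ ≗ opposite (Inc g∈EC v σ))
        Inc-g⊎opposite with parity (|L₀| γ∈EC) in eq
        ... | 0ℙ = inj₁ (even⇒Inc≗Inc-g eq)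
        ... | 1ℙ = inj₂ (odd⇒Inc≗opposite eq)

        -- Comparing the maps at one fixed player and cancelling its weight leaves the parity of
        -- `|L₀|`. A fixed player must be given, as maps on an empty set always agree.
        Inc≗Inc-g⇒even : ∃ (F π) → Inc γ∈EC v σ ≗ Inc g∈EC v σ → parity (|L₀| γ∈EC) ≡ 0ℙ
        Inc≗Inc-g⇒even i Inc≗ = ℙ.+-cancelˡ-≡ w (parity (|L₀| γ∈EC)) 0ℙ (begin
          w ℙ.+ parity (|L₀| γ∈EC)              ≡⟨ ℙ.+-homo-+ (weight (proj₁ i)) (|L₀| γ∈EC) ⟨
          parity (weight (proj₁ i) ℕ.+ |L₀| γ∈EC) ≡⟨ fromParity-injective
            (≡.trans (≡.sym (Inc≡ γ∈EC i)) (≡.trans (Inc≗ i) (Inc-g≡ i))) ⟩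
          w                                     ≡⟨ ℙ.+-identityʳ w ⟨
          w ℙ.+ 0ℙ                              ∎)
          where
          open ≡.≡-Reasoning
          w = parity (weight (proj₁ i))

      -- Counting equilibria with one distinguished fixed player.

      module _ {i₀ : Fin m} (i₀∈F : i₀ ∈ F π) where

        free : List (Fin m)
        free = filter (F? π) (allFin m) except i₀

        free-unique : Unique free
        free-unique = Unique.filter⁺ _ (Unique.filter⁺ (F? π) (Unique.allFin⁺ m))

        ∈-free⁺ : ∀ {i} → i ∈ F π → i ≢ i₀ → i ∈ₗ free
        ∈-free⁺ i∈F = ∈-filter⁺ (λ j → ¬? (j Fin.≟ i₀)) (∈-filter⁺ (F? π) (∈-allFin _) i∈F)

        ∈-free⁻ : ∀ {i} → i ∈ₗ free → i ∈ F π × i ≢ i₀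
        ∈-free⁻ i∈free
          with i∈ , i≢i₀ ← ∈-filter⁻ (λ j → ¬? (j Fin.≟ i₀)) {xs = filter (F? π) (allFin m)} i∈free =
          proj₂ (∈-filter⁻ (F? π) {xs = allFin m} i∈) , i≢i₀

        -- Numbers the choices of one bit per free player, so that cardinalities can be read off the
        -- type.
        Code : Set
        Code = Fin (2 ℕ.^ length free)

        encode : (Fin m → Fin 2) → Code
        encode b = funToFin (b ∘ lookup free)

        -- The last clause is only reached off F(π), where vertex ignores the value.
        decode : Fin 2 → Code → Fin m → Fin 2
        decode x c i with i Fin.≟ i₀ | Any.any? (i Fin.≟_) free
        ... | yes _ | _          = x
        ... | no  _ | yes i∈free = finToFun c (Any.index i∈free)
        ... | no  _ | no  _      = x

        decode-i₀ : ∀ x c → decode x c i₀ ≡ x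
        decode-i₀ x c with i₀ Fin.≟ i₀ | Any.any? (i₀ Fin.≟_) free
        ... | yes _    | _ = ≡.refl
        ... | no i₀≢i₀ | _ = ⊥-elim (i₀≢i₀ ≡.refl)

        decode-lookup : ∀ x c k → decode x c (lookup free k) ≡ finToFun c k
        decode-lookup x c k with lookup free k Fin.≟ i₀ | Any.any? (lookup free k Fin.≟_) free
        ... | yes eq | _     = ⊥-elim (proj₂ (∈-free⁻ (∈-lookup k)) eq)
        -- The search may return any membership proof; since `free` has no repetitions, its position
        -- can only be `k`.
        ... | no _   | yes p = ≡.cong (finToFun c) (index-∈-lookup free-unique k p)
        ... | no _   | no ∉  = ⊥-elim (∉ (∈-lookup k))

        encode-cong : ∀ {b b′} → (∀ {i} → i ∈ F π → b i ≡ b′ i) → encode b ≡ encode b′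
        encode-cong eq = funToFin-cong λ k → eq (proj₁ (∈-free⁻ (∈-lookup k)))

        encode-injective : ∀ {b b′} → encode b ≡ encode b′ → ∀ {i} → i ∈ F π → i ≢ i₀ → b i ≡ b′ i
        encode-injective {b} {b′} eq {i} i∈F i≢i₀ = begin
          b i                                    ≡⟨ ≡.cong b i≡ ⟩
          b (lookup free k)                      ≡⟨ Fin.finToFun-funToFin (b ∘ lookup free) k ⟨
          finToFun (encode b) k                  ≡⟨ ≡.cong (λ c → finToFun c k) eq ⟩
          finToFun (encode b′) k                 ≡⟨ Fin.finToFun-funToFin (b′ ∘ lookup free) k ⟩
          b′ (lookup free k)                     ≡⟨ ≡.cong b′ i≡ ⟨
          b′ i                                   ∎
          where
          open ≡.≡-Reasoning
          k = Any.index (∈-free⁺ i∈F i≢i₀)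
          i≡ : i ≡ lookup free k
          i≡ = lookup-index (∈-free⁺ i∈F i≢i₀)

        point : Fin 2 → Code → Point m
        point x c = vertex (decode x c)

        point∈EC : ∀ x c → point x c ∈ EC a π
        point∈EC x c = vertex∈EC (decode x c)

        bits-point-i₀ : ∀ x c → bits (point∈EC x c) i₀ ≡ x
        bits-point-i₀ x c = ≡.trans (bits-vertex (decode x c) i₀∈F) (decode-i₀ x c)

        encode-point : ∀ x c → encode (bits (point∈EC x c)) ≡ c
        encode-point x c = ≡.trans (encode-cong (bits-vertex (decode x c)))
          (≡.trans (funToFin-cong (decode-lookup x c)) (Fin.funToFin-finToFin {length free} c))

        encode≡⇒≈ : ∀ {γ γ′} (γ∈EC : γ ∈ EC a π) (γ′∈EC : γ′ ∈ EC a π) →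
          encode (bits γ∈EC) ≡ encode (bits γ′∈EC) → ∀ {j} → j ≢ i₀ → γ j ≈ γ′ j
        encode≡⇒≈ γ∈EC γ′∈EC eq j≢i₀ =
          bits≡⇒≈ γ∈EC γ′∈EC λ j∈F → encode-injective eq j∈F j≢i₀

        ≈-everywhere : ∀ {γ γ′ : Point m} → (∀ {j} → j ≢ i₀ → γ j ≈ γ′ j) → γ i₀ ≈ γ′ i₀ →
          ∀ i → γ i ≈ γ′ i
        ≈-everywhere off at i with i Fin.≟ i₀
        ... | yes ≡.refl = at
        ... | no  i≢i₀   = off i≢i₀

        -- A point is determined by its bits on F(π). Splitting off the bit at `i₀` exhibits the
        -- cardinality as twice the number of codes.
        |EC| : HasCardinality (EC a π) (2 * 2 ℕ.^ length free)
        |EC| = injection∧section⇒inverse _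
          (λ (γ , γ∈EC) → combine (bits γ∈EC i₀) (encode (bits γ∈EC)))
          (λ {(_ , γ∈EC)} {(_ , γ′∈EC)} γ≈γ′ → ≡.cong₂ combine
            (≈⇒bits≡ γ∈EC γ′∈EC i₀∈F (γ≈γ′ i₀))
            (encode-cong λ {i} i∈F → ≈⇒bits≡ γ∈EC γ′∈EC i∈F (γ≈γ′ i)))
          (λ {(_ , γ∈EC)} {(_ , γ′∈EC)} eq →
            let eq₀ , eq₁ = Fin.combine-injective _ _ _ _ eq in
            ≈-everywhere (encode≡⇒≈ γ∈EC γ′∈EC eq₁) (bits≡⇒≈ γ∈EC γ′∈EC (const eq₀)))
          (λ k → let x , c = remQuot {2} (2 ℕ.^ length free) k in point x c , point∈EC x c)
          (λ k → let x , c = remQuot {2} (2 ℕ.^ length free) k in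
            ≡.trans (≡.cong₂ combine (bits-point-i₀ x c) (encode-point x c))
                    (Fin.combine-remQuot {2} (2 ℕ.^ length free) k))

        |L₀|-point : ∀ c → |L₀| (point∈EC zero c) ≡ suc (|L₀| (point∈EC (Fin.suc zero) c))
        |L₀|-point c = |L₀|-toggle (point∈EC zero c) (point∈EC (Fin.suc zero) c)
          (encode≡⇒≈ (point∈EC zero c) (point∈EC (Fin.suc zero) c)
            (≡.trans (encode-point zero c) (≡.sym (encode-point (Fin.suc zero) c))))
          (at zero) (at (Fin.suc zero))
          where
          at : ∀ x → point x c i₀ ≈ value x
          at x = reflexive (≡.trans (vertex-on-F (decode x c) i₀∈F) (≡.cong value (decode-i₀ x c)))

        -- For a given code the two bits at `i₀` yield consecutive sizes of the zero set, so one of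
        -- them has the desired parity.
        point-of-parity : ∀ p c → ∃[ x ] parity (|L₀| (point∈EC x c)) ≡ p
        point-of-parity p c
          with parity (|L₀| (point∈EC (Fin.suc zero) c)) ℙ.≟ p
        ... | yes eq = Fin.suc zero , eq
        ... | no ≢p  = zero , ≡.trans (≡.cong parity (|L₀|-point c))
                         (≡.trans (parity-suc (|L₀| (point∈EC (Fin.suc zero) c))) (≢⇒⁻¹≡ ≢p))

        opposite-attained : ∃[ γ ] Σ[ γ∈EC ∈ (γ ∈ EC a π) ] (Inc γ∈EC v σ ≗ opposite (Inc g∈EC v σ))
        -- The code is arbitrary: only the odd size of the zero set counts.
        opposite-attained with x , odd ← point-of-parity 1ℙ (encode (const zero)) =
          _ , point∈EC x _ , odd⇒Inc≗opposite (point∈EC x _) odd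

        Nash⇒weight-parity : ∀ {γ} (γ∈EC : γ ∈ EC a π) → IsNash U γ →
          ∀ {i} → i ∈ F π → parity (weight i) ≡ parity (|L₀| γ∈EC)
        Nash⇒weight-parity γ∈EC nash {i} i∈F = parity-+≡0⇒≡ (weight i) _ (Nash⇒even γ∈EC nash i∈F)

        -- An equilibrium must have `|L₀|` of the same parity as the common weight. Given the code,
        -- this leaves exactly one bit at `i₀`, and `point-of-parity` supplies it.
        |EC∩Nash| : (∀ i → i ∈ F π → parity (weight i) ≡ parity (weight i₀)) →
          HasCardinality (EC a π ∩ IsNash U) (2 ℕ.^ length free)
        |EC∩Nash| constant = injection∧section⇒inverse _
          (λ (γ , γ∈EC , _) → encode (bits γ∈EC))
          (λ {(_ , γ∈EC , _)} {(_ , γ′∈EC , _)} γ≈γ′ →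
            encode-cong λ {i} i∈F → ≈⇒bits≡ γ∈EC γ′∈EC i∈F (γ≈γ′ i))
          (λ {(_ , γ∈EC , nash)} {(_ , γ′∈EC , nash′)} eq →
            let off = encode≡⇒≈ γ∈EC γ′∈EC eq in
            ≈-everywhere off (|L₀|-parity-injective γ∈EC γ′∈EC i₀∈F off
              (≡.trans (≡.sym (Nash⇒weight-parity γ∈EC nash i₀∈F))
                       (Nash⇒weight-parity γ′∈EC nash′ i₀∈F))))
          (λ c → let x , par = point-of-parity (parity (weight i₀)) c in
            point x c , point∈EC x c ,
            even⇒Nash (point∈EC x c) λ {i} i∈F →
              ≡⇒parity-+≡0 (weight i) _ (≡.trans (constant i i∈F) (≡.sym par)))
          (λ c → encode-point _ c)

        -- The dichotomy is decidable, being a comparison of finitely many parities: a single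
        -- equilibrium forces all weights on F(π) to share the parity of its `|L₀|`.
        none-or-half : (∀ γ → γ ∈ EC a π → ¬ IsNash U γ)
          ⊎ (∃[ n ] HasCardinality (EC a π) (2 * n) × HasCardinality (EC a π ∩ IsNash U) n)
        none-or-half
          with Fin.all? (λ i → F? π i →-dec (parity (weight i) ℙ.≟ parity (weight i₀)))
        ... | yes constant = inj₂ (2 ℕ.^ length free , |EC| , |EC∩Nash| constant)
        ... | no ¬constant = inj₁ λ γ γ∈EC nash → ¬constant λ i i∈F →
          ≡.trans (Nash⇒weight-parity γ∈EC nash i∈F) (≡.sym (Nash⇒weight-parity γ∈EC nash i₀∈F))

theorem3p7 : ∀ {c ℓ₁ ℓ₂ ℓ₃} (R : RealNumbers c ℓ₁ ℓ₂ ℓ₃) →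
  let open Games R in
  (m : ℕ) → 1 ≤ m →
  (U : TwoActionGame m) (v : Fin m → Fin 2) (a : Fin m → Fin m → RealNumbers.Carrier R) →
  IsProductGame U v a →
  (σ : Fin m → Permutation′ m) → (∀ j → IsAssociatedPermutation a j (σ j)) →
  (π : Permutation′ m) → ∃ (F π) →
  -- (i)
  (∀ γ (γ∈EC : γ ∈ EC a π) → IsNash U γ ⇔ (∀ i → Inc γ∈EC v σ i ≡ zero))
  ×
  -- (ii)
  (Σ[ g∈EC ∈ (g a π ∈ EC a π) ]
    (∀ γ (γ∈EC : γ ∈ EC a π) →
      (Inc γ∈EC v σ ≗ Inc g∈EC v σ) ⊎ (Inc γ∈EC v σ ≗ opposite (Inc g∈EC v σ)))
    × (∃[ γ ] Σ[ γ∈EC ∈ (γ ∈ EC a π) ] (Inc γ∈EC v σ ≗ opposite (Inc g∈EC v σ)))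
    × (∀ γ (γ∈EC : γ ∈ EC a π) →
      (Inc γ∈EC v σ ≗ Inc g∈EC v σ) ⇔ (2 ∣ length (L₀-list γ∈EC))))
  ×
  -- (iii)
  ((∀ γ → γ ∈ EC a π → ¬ IsNash U γ)
    ⊎ (∃[ n ] HasCardinality (EC a π) (2 * n) × HasCardinality (EC a π ∩ IsNash U) n))
theorem3p7 R m _ U v a isProductGame σ σ-assoc π (i₀ , i₀∈F) =
    Nash⇔Inc≡0
  , ( g∈EC
    , (λ γ → Inc-g⊎opposite)
    , opposite-attained i₀∈F
    , λ γ γ∈EC → mk⇔
        (parity≡0⇒2∣ _ ∘ Inc≗Inc-g⇒even γ∈EC (i₀ , i₀∈F))
        (even⇒Inc≗Inc-g γ∈EC ∘ 2∣⇒parity≡0))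
  , none-or-half i₀∈F
  where open ProductGame R isProductGame σ σ-assoc π
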